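{- Let $n>t\ge 2$ be integers. If a $K_{t+2}$-minor-free graph $U$ contains every $n$-vertex graph of pathwidth at most $t$ as a subgraph, then $U$ has at least $2^{(n-t-4)/t}$ vertices.
   Context: "$U$ contains $H$ as a subgraph" means $U$ has a subgraph isomorphic to $H$. Pathwidth is the usual notion. -}

module Defs where

open import Data.Nat using (ℕ; zero; suc; _+_; _*_; _^_; _≤_; _<_)
open import Data.Fin using (Fin)
open import Data.Fin.Subset using (Subset; _∈_; ∣_∣)
open import Data.Bool using (Bool; true; false)
open import Data.Maybe using (Maybe; just)
open import Data.Vec using (Vec; lookup; head; last)
open import Data.Product using (Σ; ∃; ∃-syntax; _×_; _,_)
open import Function.Definitions using (Injective)
open import Relation.Binary.PropositionalEquality using (_≡_; _≢_)
open import Relation.Nullary using (¬_)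

record Graph : Set where
  field
    size  : ℕ
    adj   : Fin size → Fin size → Bool
    sym   : ∀ u v → adj u v ≡ adj v u
    irrefl : ∀ v → adj v v ≡ false

open Graph public

Adj : (G : Graph) → Fin (size G) → Fin (size G) → Set
Adj G u v = adj G u v ≡ true

ContainsSubgraph : (U H : Graph) → Set
ContainsSubgraph U H =
  Σ (Fin (size H) → Fin (size U)) λ f →
    Injective _≡_ _≡_ f × (∀ u v → Adj H u v → Adj U (f u) (f v))

record WalkWithin (G : Graph) (P : Fin (size G) → Set) (u v : Fin (size G)) : Set where
  field
    len   : ℕ
    verts : Vec (Fin (size G)) (suc len)
    start : head verts ≡ u
    end   : last verts ≡ v
    inside : ∀ i → P (lookup verts i)
    steps : ∀ (i : Fin len) →
            Adj G (lookup verts (Data.Fin.inject₁ i)) (lookup verts (Data.Fin.suc i))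

-- G has the complete graph K_k as a minor: there are k pairwise disjoint,
-- nonempty, connected branch sets (vertex v lies in branch set i iff
-- β v ≡ just i; vertices with β v ≡ nothing are deleted), and any two
-- distinct branch sets are joined by an edge.
HasCompleteMinor : (k : ℕ) → Graph → Set
HasCompleteMinor k G =
  Σ (Fin (size G) → Maybe (Fin k)) λ β →
      (∀ i → ∃[ v ] β v ≡ just i)
    × (∀ i u v → β u ≡ just i → β v ≡ just i →
         WalkWithin G (λ w → β w ≡ just i) u v)
    × (∀ i j → i ≢ j → ∃[ u ] ∃[ v ] (β u ≡ just i × β v ≡ just j × Adj G u v))

CompleteMinorFree : ℕ → Graph → Set
CompleteMinorFree k G = ¬ HasCompleteMinor k G

record PathDecomposition (G : Graph) (w : ℕ) : Set where
  field
    len    : ℕ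
    bag    : Fin len → Subset (size G)
    small  : ∀ i → ∣ bag i ∣ ≤ suc w
    vcover : ∀ v → ∃[ i ] v ∈ bag i
    ecover : ∀ u v → Adj G u v → ∃[ i ] (u ∈ bag i × v ∈ bag i)
    contig : ∀ v (i j k : Fin len) → Data.Fin._≤_ i j → Data.Fin._≤_ j k →
             v ∈ bag i → v ∈ bag k → v ∈ bag j

PathwidthAtMost : ℕ → Graph → Set
PathwidthAtMost w G = PathDecomposition G w

{-# OPTIONS --safe #-}
module Submission where

open import Defs
open import Data.Bool using (Bool; true; false; not; _∨_)
open import Data.Bool.Properties using (∨-comm)
open import Data.Empty using (⊥; ⊥-elim)
open import Data.Fin using (Fin; zero; suc; toℕ; fromℕ<; inject₁; splitAt; join; _↑ˡ_; _↑ʳ_; combine; funToFin; finToFun)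
open import Data.Fin.Properties using (_≟_; any?; toℕ-injective; toℕ-fromℕ<; fromℕ<-toℕ; toℕ<n; toℕ-inject₁; splitAt-↑ˡ; splitAt-↑ʳ; splitAt-join; join-splitAt; ↑ʳ-injective; pigeonhole; funToFin-finToFin; finToFun-funToFin)
open import Data.Fin.Subset using (Subset; inside; outside; ⁅_⁆; ∣_∣; _∪_) renaming (_∈_ to _∈ˢ_; ⊥ to ∅)
open import Data.Fin.Subset.Properties using (∣⊥∣≡0; ∉⊥; x∈⁅x⁆; x∈⁅y⁆⇒x≡y; ∣⁅x⁆∣≡1; x∈p∪q⁺; x∈p∪q⁻; ∪-identityˡ; ∣p∣≤∣x∷p∣)
open import Data.List using (List; []; _∷_; _++_; length; tabulate)
import Data.List.Membership.DecPropositional as DecMembership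
open import Data.List.Membership.Propositional using (_∈_; _∉_)
open import Data.List.Membership.Propositional.Properties using (∈-++⁺ˡ; ∈-++⁺ʳ; ∈-++⁻; ∈-tabulate⁺; ∈-tabulate⁻)
open import Data.List.Properties using (length-tabulate)
open import Data.List.Relation.Unary.Any using (here; there)
open import Data.Maybe using (Maybe; just; nothing)
open import Data.Nat using (ℕ; zero; suc; _+_; _*_; _^_; _∸_; _≤_; _<_; z≤n; s≤s; s≤s⁻¹)
import Data.Nat as ℕ
open import Data.Nat.DivMod using (_mod_; m<n⇒m%n≡m; m%n<n)
import Data.Nat.Properties as ℕ
open import Data.Nat.Tactic.RingSolver using (solve-∀)
open import Data.Product using (∃; ∃-syntax; _×_; _,_; proj₁; proj₂)
open import Data.Sum using (_⊎_; inj₁; inj₂)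
import Data.Sum as Sum
open import Data.Unit using (⊤; tt)
open import Data.Vec using ([]; _∷_)
open import Function using (_∘_)
open import Relation.Binary.Definitions using (tri<; tri≈; tri>)
open import Relation.Binary.PropositionalEquality using (_≡_; _≢_; refl; trans; cong; cong₂; subst; subst₂)
  renaming (sym to ≡-sym)
open import Relation.Nullary using (¬_; Dec; yes; no; does; contradiction)
open import Relation.Nullary.Decidable using (_⊎-dec_; dec-true; dec-false; decidable-stable)

-- Take the cones over triangulated strips: s = t − 2 apex vertices, adjacent to one another and to
-- everything else, and a strip 0, 1, 2, … in which k + 2 is joined to k + 1 and to c k. The chords
-- c encode a binary word. Suppose |U|^t is smaller than the number of words. Then two such graphs
-- embed in U with the same images of the apexes and of both ends of the strip. A connected set of
-- vertices off the first strip is attached only to pairwise adjacent vertices of it, and to at most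
-- two of them: otherwise U has a triangle of the first strip and a connected set attached to all of
-- its vertices, which with the apexes form a K_{t+2} minor. Since the second strip starts and ends
-- on the first one and cannot be cut by two of its vertices into a piece free of both ends, it stays
-- on the first strip. Hence the two strips are the same graph on the same vertices, and removing
-- vertices of degree two from the far end recovers the word.

-- Complete minors from a clique and a connected set

module Minor (U : Graph) where

  private
    V = Fin (size U)

  Adj-sym : ∀ {u v} → Adj U u v → Adj U v u
  Adj-sym {u} {v} a = trans (sym U v u) a

  Adj⇒≢ : ∀ {u v} → Adj U u v → u ≢ v
  Adj⇒≢ {u} a refl with () ← trans (≡-sym a) (irrefl U u)

  -- An inductive form of `WalkWithin`, for which concatenation is a plain recursion.
  data Path (P : V → Set) : V → V → Set where
    stop : ∀ {u} → P u → Path P u u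
    step : ∀ {u v w} → P u → Adj U u v → Path P v w → Path P u w

  Path-map : ∀ {P Q : V → Set} → (∀ {x} → P x → Q x) → ∀ {u v} → Path P u v → Path Q u v
  Path-map h (stop p)     = stop (h p)
  Path-map h (step p a q) = step (h p) a (Path-map h q)

  infixr 5 _◅◅_
  _◅◅_ : ∀ {P : V → Set} {u v w} → Path P u v → Path P v w → Path P u w
  stop _     ◅◅ r = r
  step p a q ◅◅ r = step p a (q ◅◅ r)

  edge : ∀ {P : V → Set} {u v} → P u → P v → Adj U u v → Path P u v
  edge p q a = step p a (stop q)

  Path⇒WalkWithin : ∀ {P : V → Set} {u v} → Path P u v → WalkWithin U P u v
  Path⇒WalkWithin {u = u} (stop p) = record
    { len = 0 ; verts = u ∷ [] ; start = refl ; end = refl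
    ; inside = λ { zero → p } ; steps = λ () }
  Path⇒WalkWithin {u = u} (step p a q) with Path⇒WalkWithin q
  ... | record { len = l ; verts = vs@(_ ∷ _) ; start = refl ; end = e ; inside = i ; steps = s } = record
    { len = suc l ; verts = u ∷ vs ; start = refl ; end = e
    ; inside = λ { zero → p ; (suc k) → i k }
    ; steps = λ { zero → a ; (suc k) → s k } }

  Connected : List V → Set
  Connected L = ∀ {u v} → u ∈ L → v ∈ L → Path (_∈ L) u v

  connected-[_] : ∀ u → Connected (u ∷ [])
  connected-[ u ] (here refl) (here refl) = stop (here refl)

  connected-++ : ∀ {L M x y} → Connected L → Connected M →
                 x ∈ L → y ∈ M → Adj U x y → Connected (L ++ M)
  connected-++ {L} {M} {x} {y} cL cM x∈L y∈M a = go
    where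
    left : ∀ {u v} → u ∈ L → v ∈ L → Path (_∈ L ++ M) u v
    left p q = Path-map ∈-++⁺ˡ (cL p q)
    right : ∀ {u v} → u ∈ M → v ∈ M → Path (_∈ L ++ M) u v
    right p q = Path-map (∈-++⁺ʳ L) (cM p q)
    x∈ = ∈-++⁺ˡ x∈L
    y∈ = ∈-++⁺ʳ L y∈M
    go : Connected (L ++ M)
    go p q with ∈-++⁻ L p | ∈-++⁻ L q
    ... | inj₁ p′ | inj₁ q′ = left p′ q′
    ... | inj₁ p′ | inj₂ q′ = left p′ x∈L ◅◅ edge x∈ y∈ a ◅◅ right y∈M q′
    ... | inj₂ p′ | inj₁ q′ = right p′ y∈M ◅◅ edge y∈ x∈ (Adj-sym a) ◅◅ left x∈L q′
    ... | inj₂ p′ | inj₂ q′ = right p′ q′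

  connected-∷ : ∀ {M x y} → Connected M → y ∈ M → Adj U x y → Connected (x ∷ M)
  connected-∷ {x = x} cM = connected-++ connected-[ x ] cM (here refl)

  Clique : ∀ {k} → (Fin k → V) → Set
  Clique q = ∀ {i j} → i ≢ j → Adj U (q i) (q j)

  infixr 5 _◂_
  _◂_ : ∀ {k} → V → (Fin k → V) → Fin (suc k) → V
  (x ◂ q) zero    = x
  (x ◂ q) (suc i) = q i

  clique-◂ : ∀ {k x} {q : Fin k → V} → Clique q → (∀ i → Adj U x (q i)) → Clique (x ◂ q)
  clique-◂ c a {zero}  {zero}  i≢j = contradiction refl i≢j
  clique-◂ c a {zero}  {suc j} _   = a j
  clique-◂ c a {suc i} {zero}  _   = Adj-sym (a i)
  clique-◂ c a {suc i} {suc j} i≢j = c (i≢j ∘ cong suc)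

  open DecMembership (_≟_ {size U}) using (_∈?_)

  -- The branch sets are `L`, with index `zero`, and the singletons of the clique vertices; all
  -- other vertices are deleted.
  clique∧connected⇒minor :
    ∀ {k} {q : Fin k → V} {L : List V} → Clique q → Connected L → ∃[ r ] r ∈ L →
    (∀ i → q i ∉ L) → (∀ i → ∃[ x ] x ∈ L × Adj U (q i) x) → HasCompleteMinor (suc k) U
  clique∧connected⇒minor {k} {q} {L} cl cL (r , r∈L) q∉L att =
    β , nonempty , connected , joined
    where
    rest : ∀ v → Dec (∃ λ i → q i ≡ v) → Maybe (Fin (suc k))
    rest v (yes (i , _)) = just (suc i)
    rest v (no _)        = nothing

    class : ∀ v → Dec (v ∈ L) → Maybe (Fin (suc k))
    class v (yes _) = just zero
    class v (no _)  = rest v (any? (λ i → q i ≟ v))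

    β : V → Maybe (Fin (suc k))
    β v = class v (v ∈? L)

    q-inj : ∀ {i j} → q i ≡ q j → i ≡ j
    q-inj {i} {j} e with i ≟ j
    ... | yes i≡j = i≡j
    ... | no  i≢j = contradiction e (Adj⇒≢ (cl i≢j))

    β-L : ∀ {v} → v ∈ L → β v ≡ just zero
    β-L {v} p with v ∈? L
    ... | yes _ = refl
    ... | no ¬p = contradiction p ¬p

    β-q : ∀ i → β (q i) ≡ just (suc i)
    β-q i with q i ∈? L
    ... | yes p = contradiction p (q∉L i)
    ... | no _ with any? (λ j → q j ≟ q i)
    ...   | yes (j , e) = cong (just ∘ suc) (q-inj e)
    ...   | no ¬e = contradiction (i , refl) ¬e

    L-β : ∀ {v} → β v ≡ just zero → v ∈ L
    L-β {v} e with v ∈? L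
    ... | yes p = p
    ... | no _ with any? (λ j → q j ≟ v)
    L-β () | no _ | yes _
    L-β () | no _ | no _

    q-β : ∀ {v i} → β v ≡ just (suc i) → q i ≡ v
    q-β {v} e with v ∈? L
    q-β () | yes _
    q-β {v} e | no _ with any? (λ j → q j ≟ v)
    q-β refl | no _ | yes (j , e) = e
    q-β () | no _ | no _

    nonempty : ∀ i → ∃[ v ] β v ≡ just i
    nonempty zero    = r , β-L r∈L
    nonempty (suc i) = q i , β-q i

    connected : ∀ i u v → β u ≡ just i → β v ≡ just i → WalkWithin U (λ w → β w ≡ just i) u v
    connected zero u v p p′ = Path⇒WalkWithin (Path-map β-L (cL (L-β p) (L-β p′)))
    connected (suc i) u v p p′ with q-β p | q-β p′
    ... | refl | refl = Path⇒WalkWithin (stop p)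

    joined : ∀ i j → i ≢ j → ∃[ u ] ∃[ v ] (β u ≡ just i × β v ≡ just j × Adj U u v)
    joined zero zero i≢j = contradiction refl i≢j
    joined zero (suc j) _ with x , x∈L , a ← att j = x , q j , β-L x∈L , β-q j , Adj-sym a
    joined (suc i) zero _ with x , x∈L , a ← att i = q i , x , β-q i , β-L x∈L , a
    joined (suc i) (suc j) i≢j = q i , q j , β-q i , β-q j , cl (i≢j ∘ cong suc)

-- Triangulated strips

-- The strip with chords c has the vertices 0, 1, 2, …; vertex k + 2 comes with the triangle
-- {k + 2, k + 1, c k}, and c (k + 1) says which of k + 1 and c k stays in the next triangle. The three
-- fixed values make 0 and the last vertex the ends and break the symmetry between 1 and 2.
record IsStrip (c : ℕ → ℕ) : Set where
  field
    c-0   : c 0 ≡ 0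
    c-1   : c 1 ≡ 1
    c-2   : c 2 ≡ 1
    c-suc : ∀ k → c (suc k) ≡ c k ⊎ c (suc k) ≡ suc k

  c≤ : ∀ k → c k ≤ k
  c≤ zero = ℕ.≤-reflexive c-0
  c≤ (suc k) with c-suc k
  ... | inj₁ e = ℕ.≤-trans (ℕ.≤-reflexive e) (ℕ.m≤n⇒m≤1+n (c≤ k))
  ... | inj₂ e = ℕ.≤-reflexive e

  -- The value 0 is dropped at `c 1`, and later values are old ones or successors. So vertex 0 has
  -- only the neighbours 1 and 2.
  0<c : ∀ k → 0 < c (suc k)
  0<c zero = ℕ.≤-reflexive (≡-sym c-1)
  0<c (suc k) with c-suc (suc k)
  ... | inj₁ e = subst (0 <_) (≡-sym e) (0<c k)
  ... | inj₂ e = subst (0 <_) (≡-sym e) ℕ.z<s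

-- Edges point upwards and are listed at their later end; the graph is the symmetric closure.
Edge : (ℕ → ℕ) → ℕ → ℕ → Set
Edge c i zero          = ⊥
Edge c i (suc zero)    = i ≡ 0
Edge c i (suc (suc k)) = i ≡ suc k ⊎ i ≡ c k

Edge? : ∀ c i j → Dec (Edge c i j)
Edge? c i zero          = no λ ()
Edge? c i (suc zero)    = i ℕ.≟ 0
Edge? c i (suc (suc k)) = i ℕ.≟ suc k ⊎-dec i ℕ.≟ c k

Edge-suc : ∀ c i → Edge c i (suc i)
Edge-suc c zero    = refl
Edge-suc c (suc i) = inj₁ refl

-- This is the third side of the triangle of `k + 2`: by `c-suc`, the vertex `c k` is an earlier
-- neighbour of `k + 1`.
Edge-c : ∀ {c} → IsStrip c → ∀ k → Edge c (c k) (suc k)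
Edge-c s zero = IsStrip.c-0 s
Edge-c s (suc k) with IsStrip.c-suc s k
... | inj₁ e = inj₂ e
... | inj₂ e = inj₁ e

Edge⇒< : ∀ {c} → IsStrip c → ∀ {i} j → Edge c i j → i < j
Edge⇒< s (suc zero)    refl        = ℕ.z<s
Edge⇒< s (suc (suc k)) (inj₁ refl) = ℕ.≤-refl
Edge⇒< s (suc (suc k)) (inj₂ refl) = s≤s (ℕ.m≤n⇒m≤1+n (IsStrip.c≤ s k))

-- One embedded strip and the connected sets attached to it

module Cone (U : Graph) (s : ℕ) (cone : Fin s → Fin (size U)) (cone-clique : Minor.Clique U cone)
            (free : ¬ HasCompleteMinor (4 + s) U) (m : ℕ) where

  open Minor U

  private
    V = Fin (size U)
    N = 5 + m

  below : ∀ {k} → suc k < N → k < N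
  below = ℕ.<-trans (ℕ.n<1+n _)

  -- Such a vertex is itself off the cone, because no vertex is adjacent to itself.
  Apex : V → Set
  Apex v = ∀ x → Adj U v (cone x)

  Attached : List V → V → Set
  Attached D v = ∃[ x ] x ∈ D × Adj U v x

  Attached-∷ : ∀ {D v w} → Attached D v → Attached (w ∷ D) v
  Attached-∷ (x , x∈D , a) = x , there x∈D , a

  -- The triangle and the cone form a clique on `3 + s` vertices, and `D` is one more branch set,
  -- joined to the cone through any of its members.
  no-triangle-attached :
    ∀ {x y z D} → Adj U x y → Adj U x z → Adj U y z → Apex x → Apex y → Apex z →
    Connected D → (∀ {v} → v ∈ D → Apex v) → x ∉ D → y ∉ D → z ∉ D →
    Attached D x → Attached D y → Attached D z → ⊥
  no-triangle-attached {x} {y} {z} {D} xy xz yz ax ay az cD aD x∉ y∉ z∉ dx@(r , r∈D , _) dy dz =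
    free (clique∧connected⇒minor {q = q} q-clique cD (r , r∈D) q∉ q-att)
    where
    q : Fin (3 + s) → V
    q = x ◂ y ◂ z ◂ cone
    q-clique : Clique q
    q-clique = clique-◂ (clique-◂ (clique-◂ cone-clique az)
                 λ { zero → yz ; (suc i) → ay i })
                 λ { zero → xy ; (suc zero) → xz ; (suc (suc i)) → ax i }
    q∉ : ∀ i → q i ∉ D
    q∉ zero                = x∉
    q∉ (suc zero)          = y∉
    q∉ (suc (suc zero))    = z∉
    q∉ (suc (suc (suc i))) p = Adj⇒≢ (aD p i) refl
    q-att : ∀ i → Attached D (q i)
    q-att zero                = dx
    q-att (suc zero)          = dy
    q-att (suc (suc zero))    = dz
    q-att (suc (suc (suc i))) = r , r∈D , Adj-sym (aD r∈D i)

  -- `F` is total on the naturals, which keeps bounds out of the index types; only its values below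
  -- `N` are constrained.
  record Embeds (c : ℕ → ℕ) (F : ℕ → V) : Set where
    field
      inj  : ∀ {i j} → i < N → j < N → F i ≡ F j → i ≡ j
      adj⁺ : ∀ {i} j → i < N → j < N → Edge c i j → Adj U (F i) (F j)
      apex : ∀ {i} → i < N → Apex (F i)

  module Embedding {c : ℕ → ℕ} {F : ℕ → V} (strip : IsStrip c) (emb : Embeds c F) where
    open IsStrip strip public
    open Embeds emb public

    Im : V → Set
    Im v = ∃ λ i → i < N × F i ≡ v

    Im? : ∀ v → Dec (Im v)
    Im? v = ℕ.anyUpTo? (λ i → F i ≟ v) N

    Im-apex : ∀ {v} → Im v → Apex v
    Im-apex (i , i<N , refl) = apex i<N

    adj-suc : ∀ i → suc i < N → Adj U (F i) (F (suc i))
    adj-suc i p = adj⁺ (suc i) (below p) p (Edge-suc c i)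

    c<N : ∀ k → k < N → c k < N
    c<N k = ℕ.≤-<-trans (c≤ k)

    adj-c : ∀ k → 2 + k < N → Adj U (F (c k)) (F (2 + k))
    adj-c k p = adj⁺ (2 + k) (c<N k (below (below p))) p (inj₂ refl)

    adj-c-suc : ∀ k → suc k < N → Adj U (F (c k)) (F (suc k))
    adj-c-suc k p = adj⁺ (suc k) (c<N k (below p)) p (Edge-c strip k)

    -- The vertex i leaves the bags when 3 + k enters, so 3 + k is adjacent to the other two vertices
    -- of the triangle {2 + k, 1 + k, c k}.
    last-common-bag :
      ∀ {i} k {D} → 3 + k < N → Connected D → (∀ {v} → v ∈ D → Apex v) →
      (∀ {l} → l < N → F l ∈ D → 3 + k ≤ l) → F (3 + k) ∈ D → Attached D (F i) →
      ¬ Edge c i (3 + k) → Edge c i (2 + k) → ⊥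
    last-common-bag {i} k {D} 3+k<N cD aD F≥ F∈D att ¬e e′ =
      no-triangle-attached (Adj-sym (adj-suc (suc k) 2+k<N)) (Adj-sym (adj-c k 2+k<N))
        (Adj-sym (adj-c-suc k 1+k<N)) (apex 2+k<N) (apex 1+k<N) (apex (c<N k k<N)) cD aD
        (earlier∉ 2+k<N ℕ.≤-refl) (earlier∉ 1+k<N (ℕ.n≤1+n _))
        (earlier∉ (c<N k k<N) (ℕ.m≤n⇒m≤1+n (ℕ.m≤n⇒m≤1+n (c≤ k))))
        (F (3 + k) , F∈D , adj-suc (2 + k) 3+k<N) (att-suc e′) (att-c e′)
      where
      2+k<N : 2 + k < N
      2+k<N = below 3+k<N
      1+k<N : 1 + k < N
      1+k<N = below 2+k<N
      k<N : k < N
      k<N = below 1+k<N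
      earlier∉ : ∀ {l} → l < N → l ≤ 2 + k → F l ∉ D
      earlier∉ l<N l≤ p = ℕ.<⇒≱ (s≤s l≤) (F≥ l<N p)
      att-next : Attached D (F (c (suc k)))
      att-next = F (3 + k) , F∈D , adj-c (suc k) 3+k<N
      att-suc : i ≡ suc k ⊎ i ≡ c k → Attached D (F (suc k))
      att-suc (inj₁ refl) = att
      att-suc (inj₂ refl) with c-suc k
      ... | inj₁ e = contradiction (inj₂ (≡-sym e)) ¬e
      ... | inj₂ e = subst (Attached D ∘ F) e att-next
      att-c : i ≡ suc k ⊎ i ≡ c k → Attached D (F (c k))
      att-c (inj₂ refl) = att
      att-c (inj₁ refl) with c-suc k
      ... | inj₁ e = subst (Attached D ∘ F) e att-next
      ... | inj₂ e = contradiction (inj₂ (≡-sym e)) ¬e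

    -- Descend from `j`: while `i` is not joined to the predecessor either, absorb the image of that
    -- predecessor into `D`. The descent must meet an index joined to `i` whose successor is not,
    -- and `last-common-bag` applies there.
    no-attached-nonedge :
      ∀ {i} j {D} → i < j → j < N → Connected D → (∀ {v} → v ∈ D → Apex v) →
      (∀ {l} → l < N → F l ∈ D → j ≤ l) → F j ∈ D → Attached D (F i) → ¬ Edge c i j → ⊥
    no-attached-nonedge (suc zero) (s≤s z≤n) _ _ _ _ _ _ ¬e = ¬e refl
    no-attached-nonedge (suc (suc zero)) (s≤s i≤1) _ _ _ _ _ _ ¬e with ℕ.m≤n⇒m<n∨m≡n i≤1
    ... | inj₁ (s≤s z≤n) = ¬e (inj₂ (≡-sym c-0))
    ... | inj₂ refl      = ¬e (inj₁ refl)
    no-attached-nonedge {i} (suc (suc (suc k))) i<j j<N cD aD F≥ F∈D att ¬e =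
      last-common-bag k j<N cD aD F≥ F∈D att ¬e
        (decidable-stable (Edge? c i (2 + k)) (no-attached-nonedge (suc (suc k))
          (ℕ.≤∧≢⇒< (s≤s⁻¹ i<j) (¬e ∘ inj₁)) (below j<N)
          (connected-∷ cD F∈D (adj-suc (2 + k) j<N))
          (λ { (here refl) → apex (below j<N) ; (there p) → aD p })
          (λ { l<N (here e) → ℕ.≤-reflexive (≡-sym (inj l<N (below j<N) e))
             ; l<N (there p) → ℕ.≤-trans (ℕ.n≤1+n _) (F≥ l<N p) })
          (here refl) (Attached-∷ att)))

    -- An additional edge would attach the singleton of `F j` to `F i`. Hence the embedded strip is
    -- an induced subgraph.
    adj⁻ : ∀ {i j} → i < j → j < N → Adj U (F i) (F j) → Edge c i j
    adj⁻ {i} {j} i<j j<N a = decidable-stable (Edge? c i j)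
      (no-attached-nonedge j i<j j<N connected-[ F j ] (λ { (here refl) → apex j<N })
        (λ { l<N (here e) → ℕ.≤-reflexive (≡-sym (inj l<N j<N e)) }) (here refl) (F j , here refl , a))

    module _ {D : List V} (cD : Connected D) (aD : ∀ {v} → v ∈ D → Apex v)
             (D-out : ∀ {v} → v ∈ D → ¬ Im v) where

      -- Together with `F j`, the set `D` stays connected and is attached to `F i`, while `F j` is
      -- its only strip vertex.
      attached-edge : ∀ {i j} → i < j → j < N → Attached D (F i) → Attached D (F j) → Edge c i j
      attached-edge {i} {j} i<j j<N di (x , x∈D , a) = decidable-stable (Edge? c i j)
        (no-attached-nonedge j i<j j<N (connected-∷ cD x∈D a)
          (λ { (here refl) → apex j<N ; (there p) → aD p })
          (λ { l<N (here e) → ℕ.≤-reflexive (≡-sym (inj l<N j<N e))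
             ; l<N (there p) → contradiction (_ , l<N , refl) (D-out p) })
          (here refl) (Attached-∷ di))

      attached-adj : ∀ {u v} → Im u → Im v → u ≢ v → Attached D u → Attached D v → Adj U u v
      attached-adj (i , i<N , refl) (j , j<N , refl) u≢v du dv with ℕ.<-cmp i j
      ... | tri< i<j _ _ = adj⁺ j i<N j<N (attached-edge i<j j<N du dv)
      ... | tri≈ _ refl _ = contradiction refl u≢v
      ... | tri> _ _ j<i = Adj-sym (adj⁺ i j<N i<N (attached-edge j<i i<N dv du))

      -- By `attached-adj` the three attachments would form a triangle.
      no-three-attached : ∀ {u v w} → Im u → Im v → Im w → u ≢ v → u ≢ w → v ≢ w →
                          Attached D u → Attached D v → Attached D w → ⊥
      no-three-attached u∈ v∈ w∈ u≢v u≢w v≢w du dv dw =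
        no-triangle-attached (attached-adj u∈ v∈ u≢v du dv) (attached-adj u∈ w∈ u≢w du dw)
          (attached-adj v∈ w∈ v≢w dv dw) (Im-apex u∈) (Im-apex v∈) (Im-apex w∈) cD aD
          (λ p → D-out p u∈) (λ p → D-out p v∈) (λ p → D-out p w∈) du dv dw

  -- The second strip stays on the first

  module SharedEnds {c d : ℕ → ℕ} {F G : ℕ → V}
             (strip-c : IsStrip c) (strip-d : IsStrip d) (emb-F : Embeds c F) (emb-G : Embeds d G)
             (first : G 0 ≡ F 0) (last : G (4 + m) ≡ F (4 + m)) where

    private
      module C = Embedding strip-c emb-F
      module D = Embedding strip-d emb-G

    open C using (Im; Im?)

    first∈Im : Im (G 0)
    first∈Im = 0 , ℕ.z<s , ≡-sym first

    last∈Im : Im (G (4 + m))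
    last∈Im = 4 + m , ℕ.≤-refl , ≡-sym last

    ends-nonadjacent : ¬ Edge c 0 (4 + m)
    ends-nonadjacent (inj₂ e) = ℕ.<⇒≢ (C.0<c (suc m)) e

    -- A stretch of the second strip off the first one. By `sound` and `complete`, `e` is the first
    -- index after `k` at which `G` is back on the first strip.
    record Run (k : ℕ) : Set where
      field
        e         : ℕ
        k<e       : k < e
        e<N       : e < N
        returns   : Im (G e)
        path      : List V
        connected : Connected path
        sound     : ∀ {v} → v ∈ path → ∃ λ l → l < N × G l ≡ v × ¬ Im v
        complete  : ∀ {l} → k ≤ l → l < e → G l ∈ path

      path-apex : ∀ {v} → v ∈ path → Apex v
      path-apex p with l , l<N , refl , _ ← sound p = D.apex l<N

      path-out : ∀ {v} → v ∈ path → ¬ Im v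
      path-out p with _ , _ , _ , v∉ ← sound p = v∉

      attached-end : Attached path (G e)
      -- The field `e` is turned into a variable, which can then be split as a successor.
      attached-end = from-predecessor e k<e e<N complete
        where
        from-predecessor : ∀ e → k < e → e < N → (∀ {l} → k ≤ l → l < e → G l ∈ path) →
                           Attached path (G e)
        from-predecessor (suc l) (s≤s k≤l) l<N h =
          G l , h k≤l ℕ.≤-refl , Adj-sym (D.adj-suc l l<N)

    -- A return exists because the last vertex is on the first strip; `fuel` bounds the number of
    -- indices left.
    run : ∀ fuel k → k < N → N ≤ k + fuel → ¬ Im (G k) → Run k
    run zero k k<N N≤k _ = contradiction (subst (N ≤_) (ℕ.+-identityʳ k) N≤k) (ℕ.<⇒≱ k<N)
    run (suc fuel) k k<N N≤ k∉ with ℕ.m≤n⇒m<n∨m≡n k<N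
    ... | inj₂ refl = contradiction last∈Im k∉
    ... | inj₁ 1+k<N with Im? (G (suc k))
    ...   | yes 1+k∈ = record
      { e = suc k ; k<e = ℕ.≤-refl ; e<N = 1+k<N ; returns = 1+k∈
      ; path = G k ∷ [] ; connected = connected-[ G k ]
      ; sound = λ { (here refl) → k , k<N , refl , k∉ }
      ; complete = λ k≤l l≤k → here (cong G (ℕ.≤-antisym (s≤s⁻¹ l≤k) k≤l)) }
    ...   | no 1+k∉ = record
      { e = e ; k<e = ℕ.<-trans (ℕ.n<1+n k) k<e ; e<N = e<N ; returns = returns
      ; path = G k ∷ path
      ; connected = connected-∷ connected (complete ℕ.≤-refl k<e) (D.adj-suc k 1+k<N)
      ; sound = λ { (here refl) → k , k<N , refl , k∉ ; (there p) → sound p }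
      ; complete = λ k≤l l<e → extend (ℕ.m≤n⇒m<n∨m≡n k≤l) l<e }
      where
      open Run (run fuel (suc k) 1+k<N (subst (N ≤_) (ℕ.+-suc k fuel) N≤) 1+k∉)
      extend : ∀ {l} → k < l ⊎ k ≡ l → l < e → G l ∈ G k ∷ path
      extend (inj₁ k<l)  l<e = there (complete k<l l<e)
      extend (inj₂ refl) _   = here refl

    run-from : ∀ k → k < N → ¬ Im (G k) → Run k
    run-from k k<N = run N k k<N (ℕ.m≤n+m N k)

    G-distinct : ∀ {i j} → i < j → j < N → G i ≢ G j
    G-distinct i<j j<N e = ℕ.<⇒≢ i<j (D.inj (ℕ.<-trans i<j j<N) j<N e)

    -- The induction in `G∈Im-below` uses two earlier neighbours, and `G 1` has only one. Here the
    -- far side of the run, beyond `e`, supplies the missing attachment.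
    G1∈Im : Im (G 1)
    G1∈Im = decidable-stable (Im? (G 1)) absurd
      where
      absurd : ¬ ¬ Im (G 1)
      absurd 1∉ = second-run (Im? (G (suc e)))
        where
        open Run (run-from 1 (s≤s (s≤s z≤n)) 1∉)
        attached-first : Attached path (G 0)
        attached-first = G 1 , complete ℕ.≤-refl k<e , D.adj-suc 0 (s≤s (s≤s z≤n))
        0≢e : G 0 ≢ G e
        0≢e = G-distinct (ℕ.<-trans ℕ.z<s k<e) e<N
        -- Otherwise the run is attached to both ends of the first strip, which would then be
        -- adjacent.
        e≢4+m : e ≢ 4 + m
        e≢4+m eq = ends-nonadjacent (C.attached-edge connected path-apex path-out ℕ.z<s ℕ.≤-refl
          (subst (Attached path) first attached-first)
          (subst (Attached path) (trans (cong G eq) last) attached-end))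
        1+e<N : suc e < N
        1+e<N = ℕ.≤∧≢⇒< e<N (e≢4+m ∘ ℕ.suc-injective)
        -- The two ends of the run give only two attachments. The third one comes
        -- from the chord at e + 1, which ends strictly between 0 and e.
        chord : ∀ e → 1 < e → suc e < N → (∀ {l} → 1 ≤ l → l < e → G l ∈ path) →
                Attached path (G (suc e))
        chord (suc (suc k)) _ h complete =
          G (d (suc k)) , complete (D.0<c k) (s≤s (D.c≤ (suc k))) , Adj-sym (D.adj-c (suc k) h)
        chord (suc zero) (s≤s ()) _ _
        att : Attached path (G (suc e))
        att = chord e k<e 1+e<N complete
        second-run : Dec (Im (G (suc e))) → ⊥
        second-run (yes 1+e∈) =
          C.no-three-attached connected path-apex path-out first∈Im returns 1+e∈
            0≢e (G-distinct ℕ.z<s 1+e<N) (G-distinct ℕ.≤-refl 1+e<N) attached-first attached-end att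
        -- The chord at `e + 1` links the two runs into one connected set, and the return of the
        -- second run is the third attachment.
        second-run (no 1+e∉) =
          C.no-three-attached
            (connected-++ connected R.connected (proj₁ (proj₂ att))
              (R.complete ℕ.≤-refl R.k<e) (Adj-sym (proj₂ (proj₂ att))))
            (λ p → Sum.[ path-apex , R.path-apex ] (∈-++⁻ path p))
            (λ p → Sum.[ path-out , R.path-out ] (∈-++⁻ path p))
            first∈Im returns R.returns
            0≢e (G-distinct (ℕ.<-trans ℕ.z<s R.k<e) R.e<N) (G-distinct (ℕ.<-trans ℕ.≤-refl R.k<e) R.e<N)
            (left attached-first) (left attached-end)
            (proj₁ R.attached-end , ∈-++⁺ʳ path (proj₁ (proj₂ R.attached-end)) , proj₂ (proj₂ R.attached-end))
          where
          module R = Run (run-from (suc e) 1+e<N 1+e∉)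
          left : ∀ {v} → Attached path v → Attached (path ++ R.path) v
          left (x , x∈ , a) = x , ∈-++⁺ˡ x∈ , a

    -- Strong induction with bound `n`. From index 2 on, both earlier neighbours are on the first
    -- strip by induction; a run starting here would have them and its return as three attachments.
    G∈Im-below : ∀ n {k} → k < n → k < N → Im (G k)
    G∈Im-below (suc n) {k} (s≤s k≤n) k<N with ℕ.m≤n⇒m<n∨m≡n k≤n
    ... | inj₁ k<n = G∈Im-below n k<n k<N
    G∈Im-below (suc n) {zero} _ _ | inj₂ _ = first∈Im
    G∈Im-below (suc n) {suc zero} _ _ | inj₂ _ = G1∈Im
    G∈Im-below (suc n) {suc (suc k)} _ 2+k<N | inj₂ refl =
      decidable-stable (Im? (G (2 + k))) λ 2+k∉ →
        let open Run (run-from (2 + k) 2+k<N 2+k∉)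
            here∈ = complete ℕ.≤-refl k<e
        in C.no-three-attached connected path-apex path-out
             (G∈Im-below n (s≤s (ℕ.m≤n⇒m≤1+n (D.c≤ k))) (D.c<N k (below (below 2+k<N))))
             (G∈Im-below n ℕ.≤-refl (below 2+k<N)) returns
             (G-distinct (s≤s (D.c≤ k)) (below 2+k<N))
             (G-distinct (ℕ.<-trans (s≤s (ℕ.m≤n⇒m≤1+n (D.c≤ k))) k<e) e<N)
             (G-distinct (ℕ.<-trans ℕ.≤-refl k<e) e<N)
             (_ , here∈ , D.adj-c k 2+k<N) (_ , here∈ , D.adj-suc (suc k) 2+k<N) attached-end

    G∈Im : ∀ {k} → k < N → Im (G k)
    G∈Im k<N = G∈Im-below N k<N k<N

  -- The two strips coincide

  module Rigid {c d : ℕ → ℕ} {F G : ℕ → V}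
               (strip-c : IsStrip c) (strip-d : IsStrip d) (emb-F : Embeds c F) (emb-G : Embeds d G)
               (first : G 0 ≡ F 0) (last : G (4 + m) ≡ F (4 + m)) where

    private
      module C = Embedding strip-c emb-F
      module D = Embedding strip-d emb-G
      module FG = SharedEnds strip-c strip-d emb-F emb-G first last
      module GF = SharedEnds strip-d strip-c emb-G emb-F (≡-sym first) (≡-sym last)

    open FG using (G-distinct)

    AgreeAbove : ℕ → Set
    AgreeAbove k = ∀ {j} → k < j → j < N → F j ≡ G j

    -- `G p` is `F q` for some `q`. By agreement, `q` above `2 + k` would force `G p` to be `G q`
    -- with `p < q`; so `q` is below `2 + k`, and the first strip is induced.
    lower-neighbour :
      ∀ {k j p} → 2 + k < N → AgreeAbove (2 + k) → G j ≡ F (2 + k) → p ≤ 2 + k →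
      Adj U (G p) (G j) → G p ≡ F (1 + k) ⊎ G p ≡ F (c k)
    lower-neighbour {k} {j} {p} 2+k<N above e p≤ a with FG.G∈Im (ℕ.≤-<-trans p≤ 2+k<N)
    ... | q , q<N , Fq≡Gp with ℕ.<-cmp q (2 + k)
    ...   | tri≈ _ refl _ = contradiction (trans (≡-sym Fq≡Gp) (≡-sym e)) (Adj⇒≢ a)
    ...   | tri> _ _ q>   = contradiction (trans (≡-sym Fq≡Gp) (above q> q<N))
                              (G-distinct (ℕ.≤-<-trans p≤ q>) q<N)
    ...   | tri< q< _ _ with C.adj⁻ q< 2+k<N (subst₂ (Adj U) (≡-sym Fq≡Gp) e a)
    ...     | inj₁ refl = inj₁ (≡-sym Fq≡Gp)
    ...     | inj₂ refl = inj₂ (≡-sym Fq≡Gp)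

    no-three-of-two : ∀ {x y z a b : V} → x ≡ a ⊎ x ≡ b → y ≡ a ⊎ y ≡ b → z ≡ a ⊎ z ≡ b →
                      x ≢ y → x ≢ z → y ≢ z → ⊥
    no-three-of-two (inj₁ refl) (inj₁ refl) _           x≢y _   _   = x≢y refl
    no-three-of-two (inj₁ refl) (inj₂ refl) (inj₁ refl) _   x≢z _   = x≢z refl
    no-three-of-two (inj₁ refl) (inj₂ refl) (inj₂ refl) _   _   y≢z = y≢z refl
    no-three-of-two (inj₂ refl) (inj₂ refl) _           x≢y _   _   = x≢y refl
    no-three-of-two (inj₂ refl) (inj₁ refl) (inj₂ refl) _   x≢z _   = x≢z refl
    no-three-of-two (inj₂ refl) (inj₁ refl) (inj₁ refl) _   _   y≢z = y≢z refl

    -- Within 0, …, k the vertex k has only two neighbours, whereas every vertex strictly between 0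
    -- and k has at least three; so only G k can coincide with F k.
    agree-step : ∀ k → 3 + k < N → AgreeAbove (3 + k) → F (3 + k) ≡ G (3 + k)
    agree-step k 3+k<N above with GF.G∈Im 3+k<N
    ... | j , j<N , e with ℕ.<-cmp j (3 + k)
    ...   | tri≈ _ refl _ = ≡-sym e
    ...   | tri> _ _ j>   = contradiction (C.inj j<N 3+k<N (trans (above j> j<N) e)) (ℕ.>⇒≢ j>)
    agree-step k 3+k<N above | zero , _ , e | tri< _ _ _
      with () ← C.inj ℕ.z<s 3+k<N (trans (≡-sym first) e)
    agree-step k 3+k<N above | suc zero , j<N , e | tri< _ _ _ =
      ⊥-elim (no-three-of-two
        (neighbour z≤n (D.adj-suc 0 j<N))
        (neighbour (s≤s (s≤s z≤n)) (Adj-sym (D.adj-suc 1 2<N)))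
        (neighbour (s≤s (s≤s (s≤s z≤n)))
          (Adj-sym (subst (λ x → Adj U (G x) (G 3)) D.c-1 (D.adj-c 1 3<N))))
        (G-distinct ℕ.z<s 2<N) (G-distinct ℕ.z<s 3<N) (G-distinct ℕ.≤-refl 3<N))
      where
      3<N : 3 < N
      3<N = ℕ.≤-<-trans (ℕ.m≤m+n 3 k) 3+k<N
      2<N : 2 < N
      2<N = below 3<N
      neighbour : ∀ {p} → p ≤ 3 + k → Adj U (G p) (G 1) → G p ≡ F (2 + k) ⊎ G p ≡ F (c (suc k))
      neighbour = lower-neighbour 3+k<N above e
    agree-step k 3+k<N above | suc (suc i) , 2+i<N , e | tri< 2+i<3+k _ _ =
      ⊥-elim (no-three-of-two
        (neighbour (ℕ.≤-trans (D.c≤ i) i≤) (D.adj-c i 2+i<N))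
        (neighbour (ℕ.≤-trans (ℕ.m≤n+m (1 + i) 2) 2+i<3+k) (D.adj-suc (suc i) 2+i<N))
        (neighbour 2+i<3+k (Adj-sym (D.adj-suc (2 + i) 3+i<N)))
        (G-distinct (s≤s (D.c≤ i)) (below 2+i<N))
        (G-distinct (s≤s (ℕ.m≤n⇒m≤1+n (ℕ.m≤n⇒m≤1+n (D.c≤ i)))) 3+i<N)
        (G-distinct (s≤s (s≤s (ℕ.n≤1+n _))) 3+i<N))
      where
      i≤ : i ≤ 3 + k
      i≤ = ℕ.≤-trans (ℕ.m≤n+m i 3) 2+i<3+k
      3+i<N : 3 + i < N
      3+i<N = ℕ.≤-<-trans 2+i<3+k 3+k<N
      neighbour : ∀ {p} → p ≤ 3 + k → Adj U (G p) (G (2 + i)) → G p ≡ F (2 + k) ⊎ G p ≡ F (c (suc k))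
      neighbour = lower-neighbour 3+k<N above e

    -- Downward induction from the last vertex, with `n` bounding the distance to `N`. It stops at 3
    -- because within 0, 1, 2 the vertex 1 has only two neighbours.
    agree-from-3 : ∀ n k → 3 + k < N → N ≤ 3 + k + n → F (3 + k) ≡ G (3 + k)
    agree-from-3 zero k 3+k<N N≤ =
      contradiction (subst (N ≤_) (ℕ.+-identityʳ (3 + k)) N≤) (ℕ.<⇒≱ 3+k<N)
    agree-from-3 (suc n) k 3+k<N N≤ = agree-step k 3+k<N above
      where
      above : AgreeAbove (3 + k)
      above 3+k<j@(s≤s (s≤s (s≤s {n = i} _))) j<N = agree-from-3 n i j<N
        (ℕ.≤-trans N≤ (ℕ.≤-trans (ℕ.≤-reflexive (ℕ.+-suc (3 + k) n)) (ℕ.+-monoˡ-≤ n 3+k<j)))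

    agree-≥3 : ∀ {j} → 3 ≤ j → j < N → F j ≡ G j
    agree-≥3 (s≤s (s≤s (s≤s {n = k} _))) j<N = agree-from-3 N k j<N (ℕ.m≤n+m N (3 + k))

    -- Since `c 2` and `d 2` are both 1, vertex 4 is joined to 1 in both strips, and its other
    -- earlier neighbour 3 is already matched.
    agree-1 : F 1 ≡ G 1
    agree-1 with lower-neighbour {2} {4} {1} 4<N (λ 4<j → agree-≥3 (ℕ.≤-trans (ℕ.m≤n+m 3 2) 4<j))
                   (≡-sym (agree-≥3 (ℕ.n≤1+n 3) 4<N)) (s≤s z≤n)
                   (subst (λ x → Adj U (G x) (G 4)) D.c-2 (D.adj-c 2 4<N))
      where
      4<N : 4 < N
      4<N = ℕ.m≤m+n 5 m
    ... | inj₁ e = contradiction (trans e (agree-≥3 ℕ.≤-refl (ℕ.m≤m+n 4 (suc m))))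
                     (G-distinct (s≤s (s≤s z≤n)) (s≤s (s≤s (s≤s (s≤s z≤n)))))
    ... | inj₂ e = ≡-sym (trans e (cong F C.c-2))

    agree : ∀ {j} → j < N → F j ≡ G j
    agree {zero} _ = ≡-sym first
    agree {suc zero} _ = agree-1
    agree {suc (suc (suc k))} j<N = agree-≥3 (s≤s (s≤s (s≤s z≤n))) j<N
    agree {suc (suc zero)} 2<N with FG.G∈Im 2<N
    ... | zero , _ , e = contradiction (trans first e) (G-distinct ℕ.z<s 2<N)
    ... | suc zero , _ , e = contradiction (trans (≡-sym agree-1) e) (G-distinct ℕ.≤-refl 2<N)
    ... | suc (suc zero) , _ , e = e
    ... | suc (suc (suc k)) , q<N , e =
      contradiction (trans (≡-sym e) (agree-≥3 (s≤s (s≤s (s≤s z≤n))) q<N))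
        (G-distinct (s≤s (s≤s (s≤s z≤n))) q<N)

    -- The first strip is induced, so `d k` is an earlier neighbour of `2 + k` in it too, and
    -- `d k ≤ k` rules out `1 + k`.
    c≡d : ∀ k → 2 + k < N → c k ≡ d k
    c≡d k 2+k<N
      with C.adj⁻ (s≤s (ℕ.m≤n⇒m≤1+n (D.c≤ k))) 2+k<N
             (subst₂ (Adj U) (≡-sym (agree (D.c<N k (below (below 2+k<N))))) (≡-sym (agree 2+k<N))
               (D.adj-c k 2+k<N))
    ... | inj₁ e = contradiction e (ℕ.<⇒≢ (s≤s (D.c≤ k)))
    ... | inj₂ e = ≡-sym e

-- Strips from binary words

pick : Fin 2 → ℕ → ℕ → ℕ
pick zero    a b = a
pick (suc _) a b = b

chords : (ℕ → Fin 2) → ℕ → ℕ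
chords w 0                   = 0
chords w 1                   = 1
chords w 2                   = 1
chords w (suc k@(suc (suc j))) = pick (w j) (chords w k) (suc k)

chords-isStrip : ∀ w → IsStrip (chords w)
chords-isStrip w = record { c-0 = refl ; c-1 = refl ; c-2 = refl ; c-suc = c-suc }
  where
  c-suc : ∀ k → chords w (suc k) ≡ chords w k ⊎ chords w (suc k) ≡ suc k
  c-suc zero       = inj₂ refl
  c-suc (suc zero) = inj₁ refl
  c-suc (suc (suc j)) with w j
  ... | zero  = inj₁ refl
  ... | suc _ = inj₂ refl

-- Bit 1 puts the chord at `3 + j`, whereas bit 0 keeps an older value, at most `2 + j`.
chords-injective : ∀ {w w′} j → chords w (2 + j) ≡ chords w′ (2 + j) →
                   chords w (3 + j) ≡ chords w′ (3 + j) → w j ≡ w′ j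
chords-injective {w} {w′} j _ _ with w j | w′ j
chords-injective j _ _ | zero     | zero     = refl
chords-injective j _ _ | suc zero | suc zero = refl
chords-injective {w} j _ e | zero | suc _ =
  contradiction e (ℕ.<⇒≢ (s≤s (IsStrip.c≤ (chords-isStrip w) (2 + j))))
chords-injective {w′ = w′} j _ e | suc _ | zero =
  contradiction (≡-sym e) (ℕ.<⇒≢ (s≤s (IsStrip.c≤ (chords-isStrip w′) (2 + j))))

-- Cones over strips and their path decompositions

∣⁅x⁆∪p∣≤1+∣p∣ : ∀ {n} (x : Fin n) (p : Subset n) → ∣ ⁅ x ⁆ ∪ p ∣ ≤ suc ∣ p ∣
∣⁅x⁆∪p∣≤1+∣p∣ zero    (b ∷ p) rewrite ∪-identityˡ p = s≤s (∣p∣≤∣x∷p∣ b p)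
∣⁅x⁆∪p∣≤1+∣p∣ (suc x) (inside ∷ p)  = s≤s (∣⁅x⁆∪p∣≤1+∣p∣ x p)
∣⁅x⁆∪p∣≤1+∣p∣ (suc x) (outside ∷ p) = ∣⁅x⁆∪p∣≤1+∣p∣ x p

-- Bags are given as lists, whose length bounds the size without a check for repetitions.
fromList : ∀ {n} → List (Fin n) → Subset n
fromList []       = ∅
fromList (x ∷ xs) = ⁅ x ⁆ ∪ fromList xs

∣fromList∣≤length : ∀ {n} (xs : List (Fin n)) → ∣ fromList xs ∣ ≤ length xs
∣fromList∣≤length {n} []   = ℕ.≤-reflexive (∣⊥∣≡0 n)
∣fromList∣≤length (x ∷ xs) =
  ℕ.≤-trans (∣⁅x⁆∪p∣≤1+∣p∣ x (fromList xs)) (s≤s (∣fromList∣≤length xs))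

∈-fromList⁺ : ∀ {n} {v : Fin n} {xs} → v ∈ xs → v ∈ˢ fromList xs
∈-fromList⁺ {v = v} (here refl) = x∈p∪q⁺ (inj₁ (x∈⁅x⁆ v))
∈-fromList⁺ (there p)           = x∈p∪q⁺ (inj₂ (∈-fromList⁺ p))

∈-fromList⁻ : ∀ {n} {v : Fin n} xs → v ∈ˢ fromList xs → v ∈ xs
∈-fromList⁻ []       p = contradiction p ∉⊥
∈-fromList⁻ (x ∷ xs) p with x∈p∪q⁻ ⁅ x ⁆ (fromList xs) p
... | inj₁ q = here (x∈⁅y⁆⇒x≡y x q)
... | inj₂ q = there (∈-fromList⁻ xs q)

module Host (s m : ℕ) {c : ℕ → ℕ} (strip : IsStrip c) where
  open IsStrip strip

  private
    N = 5 + m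
    Vertex = Fin s ⊎ Fin N

  adjᵛ : Vertex → Vertex → Bool
  adjᵛ (inj₁ x) (inj₁ y) = not (does (x ≟ y))
  adjᵛ (inj₁ _) (inj₂ _) = true
  adjᵛ (inj₂ _) (inj₁ _) = true
  adjᵛ (inj₂ i) (inj₂ j) =
    does (Edge? c (toℕ i) (toℕ j)) ∨ does (Edge? c (toℕ j) (toℕ i))

  adjᵛ-sym : ∀ x y → adjᵛ x y ≡ adjᵛ y x
  adjᵛ-sym (inj₁ x) (inj₂ j) = refl
  adjᵛ-sym (inj₂ i) (inj₁ y) = refl
  adjᵛ-sym (inj₂ i) (inj₂ j) = ∨-comm (does (Edge? c (toℕ i) (toℕ j))) _
  adjᵛ-sym (inj₁ x) (inj₁ y) with x ≟ y | y ≟ x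
  ... | yes _ | yes _ = refl
  ... | no _  | no _  = refl
  ... | yes e | no ¬e = contradiction (≡-sym e) ¬e
  ... | no ¬e | yes e = contradiction (≡-sym e) ¬e

  adjᵛ-irrefl : ∀ x → adjᵛ x x ≡ false
  adjᵛ-irrefl (inj₁ x) = cong not (dec-true (x ≟ x) refl)
  adjᵛ-irrefl (inj₂ i)
    rewrite dec-false (Edge? c (toℕ i) (toℕ i)) (ℕ.<-irrefl refl ∘ Edge⇒< strip (toℕ i)) = refl

  adjᵛ-cones : ∀ {x y} → x ≢ y → adjᵛ (inj₁ x) (inj₁ y) ≡ true
  adjᵛ-cones {x} {y} x≢y = cong not (dec-false (x ≟ y) x≢y)

  adjᵛ-strip : ∀ {i j} → Edge c (toℕ i) (toℕ j) → adjᵛ (inj₂ i) (inj₂ j) ≡ true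
  adjᵛ-strip {i} {j} e rewrite dec-true (Edge? c (toℕ i) (toℕ j)) e = refl

  graph : Graph
  graph = record
    { size = s + N
    ; adj = λ u v → adjᵛ (splitAt s u) (splitAt s v)
    ; sym = λ u v → adjᵛ-sym (splitAt s u) (splitAt s v)
    ; irrefl = λ v → adjᵛ-irrefl (splitAt s v) }

  -- Bag `k` meets the strip in the triangle of `2 + k`.
  InBag : ℕ → ℕ → Set
  InBag v k = v ≡ 2 + k ⊎ Edge c v (2 + k)

  -- The newcomer of bag `k + 1` is `3 + k`, too large for bag `i`. The other members, `2 + k` and
  -- `c (k + 1)`, are already in bag `k`.
  InBag-pred : ∀ {v i k} → i ≤ k → InBag v i → InBag v (suc k) → InBag v k
  InBag-pred {v} {i} {k} i≤k p = last-bag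
    where
    v≤2+i : InBag v i → v ≤ 2 + i
    v≤2+i (inj₁ refl) = ℕ.≤-refl
    v≤2+i (inj₂ e)    = ℕ.<⇒≤ (Edge⇒< strip (2 + i) e)
    last-bag : InBag v (suc k) → InBag v k
    last-bag (inj₁ refl) = contradiction (ℕ.≤-trans (v≤2+i p) (s≤s (s≤s i≤k))) (ℕ.<⇒≱ ℕ.≤-refl)
    last-bag (inj₂ (inj₁ refl)) = inj₁ refl
    last-bag (inj₂ (inj₂ refl)) with c-suc k
    ... | inj₁ e = inj₂ (inj₂ e)
    ... | inj₂ e = inj₂ (inj₁ e)

  InBag-convex : ∀ {v i j} k → i ≤ j → j ≤ k → InBag v i → InBag v k → InBag v j
  InBag-convex zero z≤n z≤n p _ = p
  InBag-convex (suc k) i≤j j≤1+k p q with ℕ.m≤n⇒m<n∨m≡n j≤1+k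
  ... | inj₂ refl  = q
  ... | inj₁ j<1+k = InBag-convex k i≤j (s≤s⁻¹ j<1+k) p
                       (InBag-pred (ℕ.≤-trans i≤j (s≤s⁻¹ j<1+k)) p q)

  Member : Vertex → Fin (3 + m) → Set
  Member (inj₁ _) _ = ⊤
  Member (inj₂ i) k = InBag (toℕ i) (toℕ k)

  c-bound : ∀ (k : Fin (3 + m)) → c (toℕ k) < N
  c-bound k = ℕ.≤-<-trans (c≤ (toℕ k)) (ℕ.<-≤-trans (toℕ<n k) (ℕ.m≤n+m (3 + m) 2))

  bagList : Fin (3 + m) → List (Fin (s + N))
  bagList k = (s ↑ʳ suc (suc k)) ∷ (s ↑ʳ suc (inject₁ k)) ∷ (s ↑ʳ fromℕ< (c-bound k)) ∷ tabulate (_↑ˡ N)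

  length-bagList : ∀ k → length (bagList k) ≡ 3 + s
  length-bagList k = cong (3 +_) (length-tabulate (_↑ˡ N))

  Member⇒∈ : ∀ x k → Member x k → join s N x ∈ bagList k
  Member⇒∈ (inj₁ x) k _ = there (there (there (∈-tabulate⁺ x)))
  Member⇒∈ (inj₂ i) k (inj₁ e) = here (cong (s ↑ʳ_) (toℕ-injective e))
  Member⇒∈ (inj₂ i) k (inj₂ (inj₁ e)) =
    there (here (cong (s ↑ʳ_) (toℕ-injective (trans e (cong suc (≡-sym (toℕ-inject₁ k)))))))
  Member⇒∈ (inj₂ i) k (inj₂ (inj₂ e)) =
    there (there (here (cong (s ↑ʳ_) (toℕ-injective (trans e (≡-sym (toℕ-fromℕ< (c-bound k))))))))

  ∈⇒Member : ∀ {v} k → v ∈ bagList k → Member (splitAt s v) k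
  ∈⇒Member k (here refl) rewrite splitAt-↑ʳ s N (suc (suc k)) = inj₁ refl
  ∈⇒Member k (there (here refl)) rewrite splitAt-↑ʳ s N (suc (inject₁ k)) =
    inj₂ (inj₁ (cong suc (toℕ-inject₁ k)))
  ∈⇒Member k (there (there (here refl))) rewrite splitAt-↑ʳ s N (fromℕ< (c-bound k)) =
    inj₂ (inj₂ (toℕ-fromℕ< (c-bound k)))
  ∈⇒Member k (there (there (there p))) with ∈-tabulate⁻ p
  ... | x , refl rewrite splitAt-↑ˡ s x N = tt

  bag : Fin (3 + m) → Subset (s + N)
  bag k = fromList (bagList k)

  ∈-bag⁺ : ∀ v k → Member (splitAt s v) k → v ∈ˢ bag k
  ∈-bag⁺ v k p = ∈-fromList⁺ (subst (_∈ bagList k) (join-splitAt s N v) (Member⇒∈ (splitAt s v) k p))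

  ∈-bag⁻ : ∀ v k → v ∈ˢ bag k → Member (splitAt s v) k
  ∈-bag⁻ v k p = ∈⇒Member k (∈-fromList⁻ (bagList k) p)

  covered : ∀ x → ∃[ k ] Member x k
  covered (inj₁ _)             = zero , tt
  covered (inj₂ zero)          = zero , inj₂ (inj₂ (≡-sym c-0))
  covered (inj₂ (suc zero))    = zero , inj₂ (inj₁ refl)
  covered (inj₂ (suc (suc k))) = k , inj₁ refl

  edge-covered : ∀ i j → Edge c (toℕ i) (toℕ j) → ∃[ k ] (Member (inj₂ i) k × Member (inj₂ j) k)
  edge-covered i (suc zero) e    = zero , inj₂ (inj₂ (trans e (≡-sym c-0))) , inj₂ (inj₁ refl)
  edge-covered i (suc (suc k)) e = k , inj₂ e , inj₁ refl

  adj-covered : ∀ x y → adjᵛ x y ≡ true → ∃[ k ] (Member x k × Member y k)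
  adj-covered (inj₁ _) y _ with k , p ← covered y = k , tt , p
  adj-covered x@(inj₂ _) (inj₁ _) _ with k , p ← covered x = k , p , tt
  adj-covered (inj₂ i) (inj₂ j) a with Edge? c (toℕ i) (toℕ j) | Edge? c (toℕ j) (toℕ i)
  ... | yes e | _     = edge-covered i j e
  ... | no _  | yes e with k , p , q ← edge-covered j i e = k , q , p

  convex : ∀ x {i j k} → toℕ i ≤ toℕ j → toℕ j ≤ toℕ k → Member x i → Member x k → Member x j
  convex (inj₁ _) _ _ _ _ = tt
  convex (inj₂ _) {k = k} i≤j j≤k = InBag-convex (toℕ k) i≤j j≤k

  pathDecomposition : PathDecomposition graph (2 + s)
  pathDecomposition = record
    { len = 3 + m
    ; bag = bag
    ; small = λ k → ℕ.≤-trans (∣fromList∣≤length (bagList k)) (ℕ.≤-reflexive (length-bagList k))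
    ; vcover = λ v → let k , p = covered (splitAt s v) in k , ∈-bag⁺ v k p
    ; ecover = λ u v a → let k , p , q = adj-covered (splitAt s u) (splitAt s v) a in
                         k , ∈-bag⁺ u k p , ∈-bag⁺ v k q
    ; contig = λ v i j k i≤j j≤k p q →
        ∈-bag⁺ v j (convex (splitAt s v) i≤j j≤k (∈-bag⁻ v i p) (∈-bag⁻ v k q)) }

-- A copy of this graph shows that `U` has a vertex when `n` is small.
edgeless : ℕ → Graph
edgeless n = record { size = n ; adj = λ _ _ → false ; sym = λ _ _ → refl ; irrefl = λ _ → refl }

edgeless-pathDecomposition : ∀ n w → PathDecomposition (edgeless n) w
edgeless-pathDecomposition n w = record
  { len = n
  ; bag = ⁅_⁆
  ; small = λ i → ℕ.≤-trans (ℕ.≤-reflexive (∣⁅x⁆∣≡1 i)) (s≤s z≤n)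
  ; vcover = λ v → v , x∈⁅x⁆ v
  ; ecover = λ _ _ ()
  ; contig = contig }
  where
  contig : ∀ v (i j k : Fin n) → toℕ i ≤ toℕ j → toℕ j ≤ toℕ k → v ∈ˢ ⁅ i ⁆ → v ∈ˢ ⁅ k ⁆ → v ∈ˢ ⁅ j ⁆
  contig v i j k i≤j j≤k p q with refl ← x∈⁅y⁆⇒x≡y i p | refl ← x∈⁅y⁆⇒x≡y k q =
    subst (λ x → v ∈ˢ ⁅ x ⁆) (toℕ-injective (ℕ.≤-antisym i≤j j≤k)) (x∈⁅x⁆ v)

-- Counting words by the images of apexes and ends

funToFin-cong : ∀ {m n} {f g : Fin m → Fin n} → (∀ i → f i ≡ g i) → funToFin f ≡ funToFin g
funToFin-cong {zero}  _ = refl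
funToFin-cong {suc m} h = cong₂ combine (h zero) (funToFin-cong (h ∘ suc))

-- The word is continued by zeros. These bits decide `c (3 + m)` and later chords, whose vertices
-- lie beyond the first `5 + m`.
extend : ∀ {m} → (Fin m → Fin 2) → ℕ → Fin 2
extend {m} w j with j ℕ.<? m
... | yes j<m = w (fromℕ< j<m)
... | no _    = zero

extend-toℕ : ∀ {m} (w : Fin m → Fin 2) i → extend w (toℕ i) ≡ w i
extend-toℕ {m} w i with toℕ i ℕ.<? m
... | yes i<m = cong w (fromℕ<-toℕ i i<m)
... | no i≮m  = contradiction (toℕ<n i) i≮m

module Universal (U : Graph) (s m : ℕ) (free : ¬ HasCompleteMinor (4 + s) U)
                 (universal : (H : Graph) → size H ≡ s + (5 + m) → PathwidthAtMost (2 + s) H →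
                              ContainsSubgraph U H) where

  private
    N = 5 + m
    V = Fin (size U)

  module Image (w : Fin m → Fin 2) where
    c : ℕ → ℕ
    c = chords (extend w)

    strip : IsStrip c
    strip = chords-isStrip (extend w)

    open Host s m strip

    private
      embedding = universal graph refl pathDecomposition
      f = proj₁ embedding
      f-injective = proj₁ (proj₂ embedding)
      f-adj = proj₂ (proj₂ embedding)

    -- Reduction modulo `N` makes `F` total and fixes every index below `N`.
    F : ℕ → V
    F i = f (s ↑ʳ (i mod N))

    cone : Fin s → V
    cone x = f (x ↑ˡ N)

    toℕ-mod : ∀ {i} → i < N → toℕ (i mod N) ≡ i
    toℕ-mod {i} i<N = trans (toℕ-fromℕ< (m%n<n i N)) (m<n⇒m%n≡m i<N)

    adj-join : ∀ x y → adjᵛ x y ≡ true → Adj U (f (join s N x)) (f (join s N y))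
    adj-join x y a = f-adj _ _
      (trans (cong₂ adjᵛ (splitAt-join s N x) (splitAt-join s N y)) a)

    cone-clique : Minor.Clique U cone
    cone-clique {x} {y} x≢y = adj-join (inj₁ x) (inj₁ y) (adjᵛ-cones x≢y)

    F-adj : ∀ {i} j → i < N → j < N → Edge c i j → Adj U (F i) (F j)
    F-adj {i} j i<N j<N e = adj-join (inj₂ (i mod N)) (inj₂ (j mod N))
      (adjᵛ-strip (subst₂ (Edge c) (≡-sym (toℕ-mod i<N)) (≡-sym (toℕ-mod j<N)) e))

    F-injective : ∀ {i j} → i < N → j < N → F i ≡ F j → i ≡ j
    F-injective i<N j<N e = trans (≡-sym (toℕ-mod i<N))
      (trans (cong toℕ (↑ʳ-injective s _ _ (f-injective e))) (toℕ-mod j<N))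

    F-cone : ∀ i x → Adj U (F i) (cone x)
    F-cone i x = adj-join (inj₂ (i mod N)) (inj₁ x) refl

    -- These are the images that two embeddings must share for `Rigid` to apply.
    pins : Fin (2 + s) → V
    pins zero          = F 0
    pins (suc zero)    = F (4 + m)
    pins (suc (suc x)) = cone x

  pins-determine-word : ∀ w w′ → (∀ x → Image.pins w x ≡ Image.pins w′ x) → ∀ i → w i ≡ w′ i
  pins-determine-word w w′ same i =
    trans (≡-sym (extend-toℕ w i)) (trans bits (extend-toℕ w′ i))
    where
    module I = Image w
    module J = Image w′
    open Cone U s I.cone I.cone-clique free m using (Embeds; module Rigid)
    emb-I : Embeds I.c I.F
    emb-I = record { inj = I.F-injective ; adj⁺ = I.F-adj ; apex = λ {i} _ → I.F-cone i }
    emb-J : Embeds J.c J.F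
    emb-J = record { inj = J.F-injective ; adj⁺ = J.F-adj
                   ; apex = λ {i} _ x → subst (Adj U (J.F i)) (≡-sym (same (suc (suc x)))) (J.F-cone i x) }
    open Rigid I.strip J.strip emb-I emb-J (≡-sym (same zero)) (≡-sym (same (suc zero))) using (c≡d)
    -- Bit `i` is read off the chord `c (3 + i)`, which belongs to vertex `5 + i`.
    5+i<N : 5 + toℕ i < N
    5+i<N = ℕ.+-monoʳ-< 5 (toℕ<n i)
    bits : extend w (toℕ i) ≡ extend w′ (toℕ i)
    bits = chords-injective {extend w} {extend w′} (toℕ i)
      (c≡d (2 + toℕ i) (ℕ.<-trans ℕ.≤-refl 5+i<N)) (c≡d (3 + toℕ i) 5+i<N)

  -- Words and pins are coded as elements of finite sets of these sizes, so the pigeonhole principle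
  -- would give two different words with the same pins.
  2^m≤size^[2+s] : 2 ^ m ≤ size U ^ (2 + s)
  2^m≤size^[2+s] = ℕ.≮⇒≥ λ lt →
    let i , j , i<j , e = pigeonhole lt (λ i → funToFin (Image.pins (finToFun i)))
        pins≡ x = trans (≡-sym (finToFun-funToFin (Image.pins (finToFun i)) x))
                    (trans (cong (λ p → finToFun p x) e) (finToFun-funToFin (Image.pins (finToFun j)) x))
        words≡ = pins-determine-word (finToFun i) (finToFun j) pins≡
    in ℕ.<⇒≢ i<j (cong toℕ (trans (≡-sym (funToFin-finToFin {m} i))
         (trans (funToFin-cong words≡) (funToFin-finToFin {m} j))))

-- The lower bound on the number of vertices

-- The exponent `n - t - 4` is at most 0 here, so one vertex suffices.
small-case : ∀ n t U → n ≤ t + 4 → 0 < size U → 2 ^ n ≤ (size U ^ t) * 2 ^ (t + 4)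
small-case n t U n≤ 0<size = begin
  2 ^ n                       ≤⟨ ℕ.^-monoʳ-≤ 2 n≤ ⟩
  2 ^ (t + 4)                 ≤⟨ ℕ.m≤n*m (2 ^ (t + 4)) (size U ^ t) {{size^t≢0}} ⟩
  (size U ^ t) * 2 ^ (t + 4)  ∎
  where
  open ℕ.≤-Reasoning
  size^t≢0 = ℕ.m^n≢0 (size U) t {{ℕ.>-nonZero 0<size}}

-- The bound is raised to the power `t` and multiplied by `2 ^ (t + 4)`, which leaves natural
-- exponents only.
theorem4p6 : (n t : ℕ) → 2 ≤ t → t < n → (U : Graph) →
    CompleteMinorFree (t + 2) U →
    ((H : Graph) → size H ≡ n → PathwidthAtMost t H → ContainsSubgraph U H) →
    2 ^ n ≤ (size U ^ t) * 2 ^ (t + 4)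
theorem4p6 (suc n) (suc (suc s)) (s≤s (s≤s z≤n)) t<n U free universal
  with ℕ.≤-total (suc n) (2 + s + 4)
... | inj₁ n≤t+4 = small-case (suc n) (2 + s) U n≤t+4 (ℕ.≤-<-trans z≤n (toℕ<n (proj₁ copy zero)))
  where
  copy = universal (edgeless (suc n)) refl (edgeless-pathDecomposition (suc n) (2 + s))
... | inj₂ t+4≤n = begin
  2 ^ suc n                              ≡⟨ cong (2 ^_) n≡ ⟩
  2 ^ (m + (2 + s + 4))                  ≡⟨ ℕ.^-distribˡ-+-* 2 m (2 + s + 4) ⟩
  2 ^ m * 2 ^ (2 + s + 4)                ≤⟨ ℕ.*-monoˡ-≤ (2 ^ (2 + s + 4)) 2^m≤ ⟩
  size U ^ (2 + s) * 2 ^ (2 + s + 4)     ∎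
  where
  open ℕ.≤-Reasoning
  m = suc n ∸ (2 + s + 4)
  n≡ : suc n ≡ m + (2 + s + 4)
  n≡ = ≡-sym (ℕ.m∸n+n≡m t+4≤n)
  -- As `t + 4` is `s + 6`, the strip has `5 + (m + 1)` vertices and carries words of length
  -- `m + 1`; `2^m≤` then gives up a factor of two.
  n≡′ : s + (5 + suc m) ≡ suc n
  n≡′ = ≡-sym (trans n≡ (solve m s))
    where
    solve : ∀ m s → m + (2 + s + 4) ≡ s + (5 + suc m)
    solve = solve-∀
  2^m≤ : 2 ^ m ≤ size U ^ (2 + s)
  2^m≤ = ℕ.≤-trans (ℕ.^-monoʳ-≤ 2 (ℕ.n≤1+n m)) (Universal.2^m≤size^[2+s] U s (suc m)
    (subst (λ k → ¬ HasCompleteMinor k U) (ℕ.+-comm (2 + s) 2) free)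
    (λ H e → universal H (trans e n≡′)))
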